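{- The following equalities of functions hold: $$\mathrm{nat2perm}\circ\mathrm{perm2nat}=\mathrm{id}_{P},\qquad \mathrm{perm2nat}\circ\mathrm{nat2perm}=\mathrm{id}_{\mathbb{N}}.$$
   Context: $\mathbb{N}=\{0,1,2,\dots\}$. $P$ is the set of all finite permutations: lists $[p_0,\dots,p_{k-1}]$, $k\ge0$, in which each element of $\{0,\dots,k-1\}$ occurs exactly once (the empty list is the unique permutation of size $0$). For $k\ge1$, the Lehmer code of a permutation $[p_0,\dots,p_{k-1}]$ of size $k$, as computed in the paper, is the list $[c_0,\dots,c_{k-1}]$ obtained as follows: start with the list $[0,1,\dots,k-1]$; for $i=0,\dots,k-1$ in turn, let $c_i$ be the position (counted from $0$) of $p_i$ in the current list, and then remove $p_i$ from the list, keeping the order of the remaining elements. (Equivalently, $c_i$ is the number of $j>i$ with $p_j<p_i$.) For $k\ge1$ and a permutation $p$ of size $k$ with Lehmer code $[c_0,\dots,c_{k-1}]$, define its rank among permutations of size $k$ by $\mathrm{perm2nth}(p)=\sum_{i=0}^{k-1}c_i\,(k-1-i)!$. For $k\ge1$ and $0\le m<k!$, define $\mathrm{nth2perm}(k,m)$ as follows: write $m$ in the factorial number system as $m=\sum_{i=0}^{k-1}d_i\, i!$ with $0\le d_i\le i$ (padding with zeros to length $k$), and let $\mathrm{nth2perm}(k,m)$ be the permutation of size $k$ reconstructed from the Lehmer code $[d_{k-1},\dots,d_1,d_0]$, i.e. start with the list $[0,\dots,k-1]$ and successively select and remove the element at position $d_{k-1}$, then $d_{k-2}$, ..., then $d_0$,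 the selected elements in order forming the permutation. Let $\mathrm{sf}(k)=\sum_{i=0}^{k-1}i!$ (so $\mathrm{sf}(0)=0$, $\mathrm{sf}(1)=1$, $\mathrm{sf}(2)=2$, $\mathrm{sf}(3)=4$). $\mathrm{perm2nat}:P\to\mathbb{N}$ is defined by $\mathrm{perm2nat}([\,])=0$ and $\mathrm{perm2nat}(p)=\mathrm{sf}(k)+\mathrm{perm2nth}(p)$ for $p$ of size $k\ge1$. $\mathrm{nat2perm}:\mathbb{N}\to P$ is defined by $\mathrm{nat2perm}(0)=[\,]$ and, for $n>0$, $\mathrm{nat2perm}(n)=\mathrm{nth2perm}(k,\,n-\mathrm{sf}(k))$, where $k$ is the unique natural number with $\mathrm{sf}(k)\le n<\mathrm{sf}(k+1)$. -}

module Defs where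

open import Data.Nat.Base using (ℕ; zero; suc; _+_; _*_; _∸_; _/_; _%_; _!; _≤_; _<_; NonZero; z≤n; s≤s; s≤s⁻¹)
open import Data.Nat.Properties
open import Data.Nat.Divisibility using (n∣m*n)
open import Data.Nat.DivMod using (m≡m%n+[m/n]*n; m%n<n; m<n⇒m%n≡m; m%[n*o]/o≡m/o%n; m∣n⇒o%n%m≡o%m; n%1≡0)
open import Data.Fin.Base using (Fin; zero; suc; toℕ; fromℕ<)
open import Data.List.Base using (List; []; _∷_; length; filter; lookup; removeAt; tabulate; upTo; downFrom; applyDownFrom)
open import Data.List.Properties using (filter-accept; filter-reject; length-upTo; length-applyDownFrom; reverse-downFrom)
open import Data.Nat.ListAction using (sum)
open import Data.List.Membership.DecPropositional _≟_ using (_∈?_)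
open import Data.List.Relation.Binary.Permutation.Propositional using (_↭_; prep; swap; ↭-refl; ↭-sym; ↭-trans)
open import Data.List.Relation.Binary.Permutation.Propositional.Properties using (↭-length; ↭-reverse; filter-↭)
open import Data.List.Relation.Unary.All using (All; []; map)
open import Data.List.Relation.Unary.All.Properties using (all-upTo)
open import Data.List.Relation.Unary.Any using (index)
open import Data.Product using (Σ; ∃!; _×_; _,_; proj₁; proj₂)
open import Data.Unit.Base using (⊤; tt)
open import Relation.Binary.PropositionalEquality using (_≡_; refl; sym; trans; cong; cong₂; subst; module ≡-Reasoning)
open import Relation.Nullary using (yes; no; contradiction)

occurrences : ℕ → List ℕ → ℕ
occurrences v ps = length (filter (v ≟_) ps)

-- Bounds on the entries need not be required: a list of length k in which
-- each of 0, …, k-1 occurs once has no other entries.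
-- `All` over `upTo`, rather than a function type, makes `isPermutation`
-- proof-irrelevant without function extensionality, so that `_≡_` on
-- `Permutation` is equality of the underlying lists.
record Permutation : Set where
  constructor mkPermutation
  field
    elements      : List ℕ
    isPermutation : All (λ v → occurrences v elements ≡ 1)
                        (upTo (length elements))

  size : ℕ
  size = length elements

open Permutation public

-- `lehmer xs ps` computes the Lehmer code of `ps` relative to the current
-- list `xs`.  The `no` case never occurs when `ps` is a rearrangement of
-- `xs`; in particular the code of a permutation has length its size.
lehmer : List ℕ → List ℕ → List ℕ
lehmer xs []       = []
lehmer xs (p ∷ ps) with p ∈? xs
... | yes p∈xs = toℕ (index p∈xs) ∷ lehmer (removeAt xs (index p∈xs)) ps
... | no  _    = []

lehmerCode : Permutation → List ℕ
lehmerCode p = lehmer (upTo (size p)) (elements p)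

-- `select xs cs` successively selects and removes from `xs` the elements
-- at the positions `cs`.  The `no` case never occurs when `cs` is a
-- Lehmer code of the same length as `xs`.
select : List ℕ → List ℕ → List ℕ
select xs []       = []
select xs (c ∷ cs) with c <? length xs
... | yes c< = lookup xs (fromℕ< c<) ∷ select (removeAt xs (fromℕ< c<)) cs
... | no  _  = []

IsLehmerCode : List ℕ → Set
IsLehmerCode []       = ⊤
IsLehmerCode (c ∷ cs) = c ≤ length cs × IsLehmerCode cs

lookup∷removeAt-↭ : (xs : List ℕ) (i : Fin (length xs)) →
                    lookup xs i ∷ removeAt xs i ↭ xs
lookup∷removeAt-↭ (x ∷ xs) zero    = ↭-refl
lookup∷removeAt-↭ (x ∷ xs) (suc i) =
  ↭-trans (swap _ x ↭-refl) (prep x (lookup∷removeAt-↭ xs i))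

select-↭ : ∀ xs cs → length xs ≡ length cs → IsLehmerCode cs →
           select xs cs ↭ xs
select-↭ []  []       _  _ = ↭-refl
select-↭ xs  (c ∷ cs) eq (c≤ , ok) with c <? length xs
... | yes c< = ↭-trans
        (prep _ (select-↭ (removeAt xs i) cs
          (suc-injective (trans (sym (length-eq xs i)) eq)) ok))
        (lookup∷removeAt-↭ xs i)
  where
  i = fromℕ< c<
  length-eq : ∀ (ys : List ℕ) j → length ys ≡ suc (length (removeAt ys j))
  length-eq ys j = sym (↭-length (lookup∷removeAt-↭ ys j))
... | no c≮ = contradiction (subst (c <_) (sym eq) (s≤s c≤)) c≮

occurrences-downFrom-≥ : ∀ v n → n ≤ v → occurrences v (downFrom n) ≡ 0
occurrences-downFrom-≥ v zero    _   = refl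
occurrences-downFrom-≥ v (suc n) n<v = trans
  (cong length (filter-reject (v ≟_) {xs = downFrom n} (>⇒≢ n<v)))
  (occurrences-downFrom-≥ v n (<⇒≤ n<v))

occurrences-downFrom-< : ∀ v n → v < n → occurrences v (downFrom n) ≡ 1
occurrences-downFrom-< v (suc n) v<1+n with v ≟ n
... | yes refl = trans
  (cong length (filter-accept (v ≟_) {xs = downFrom n} refl))
  (cong suc (occurrences-downFrom-≥ v n ≤-refl))
... | no v≢n   = trans
  (cong length (filter-reject (v ≟_) {xs = downFrom n} v≢n))
  (occurrences-downFrom-< v n (≤∧≢⇒< (s≤s⁻¹ v<1+n) v≢n))

↭-upTo⇒isPermutation : ∀ k {ps} → ps ↭ upTo k →
  All (λ v → occurrences v ps ≡ 1) (upTo (length ps))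
↭-upTo⇒isPermutation k {ps} ps↭ =
  subst (λ n → All (λ v → occurrences v ps ≡ 1) (upTo n))
    (sym (trans (↭-length ps↭) (length-upTo k)))
    (map (λ {v} v<k → trans (↭-length (filter-↭ (v ≟_) ps↭downFrom))
                            (occurrences-downFrom-< v k v<k))
         (all-upTo k))
  where
  ps↭downFrom : ps ↭ downFrom k
  ps↭downFrom = ↭-trans ps↭
    (subst (_↭ downFrom k) (reverse-downFrom k) (↭-reverse (downFrom k)))

applyDownFrom-isLehmerCode : ∀ (d : ℕ → ℕ) k → (∀ i → i < k → d i ≤ i) →
                             IsLehmerCode (applyDownFrom d k)
applyDownFrom-isLehmerCode d zero    d≤ = tt
applyDownFrom-isLehmerCode d (suc k) d≤ =
  subst (d k ≤_) (sym (length-applyDownFrom d k)) (d≤ k (n<1+n k)) ,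
  applyDownFrom-isLehmerCode d k (λ i i<k → d≤ i (m<n⇒m<1+n i<k))

fromLehmerCode : (cs : List ℕ) → IsLehmerCode cs → Permutation
fromLehmerCode cs ok = mkPermutation (select (upTo k) cs)
  (↭-upTo⇒isPermutation k (select-↭ (upTo k) cs (length-upTo k) ok))
  where k = length cs

-- Only the digits `digit i` with `i < k` are meaningful.
record FactorialRep (k m : ℕ) : Set where
  field
    digit   : ℕ → ℕ
    digit≤  : ∀ i → i < k → digit i ≤ i
    digit-Σ : sum (applyDownFrom (λ i → digit i * i !) k) ≡ m

  -- [d_{k-1}, …, d₁, d₀]
  code : List ℕ
  code = applyDownFrom digit k

  code-isLehmerCode : IsLehmerCode code
  code-isLehmerCode = applyDownFrom-isLehmerCode digit k digit≤

infixl 7 _/!_ _%!_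

_/!_ : ℕ → ℕ → ℕ
m /! k = (m / k !) {{k !≢0}}

_%!_ : ℕ → ℕ → ℕ
m %! k = (m % k !) {{k !≢0}}

%!-suc : ∀ m k → m %! suc k ≡ ((m /! k) % suc k) * k ! + m %! k
%!-suc m k = begin
  x                              ≡⟨ m≡m%n+[m/n]*n x (k !) ⟩
  x % k ! + (x / k !) * k !      ≡⟨ +-comm (x % k !) _ ⟩
  (x / k !) * k ! + x % k !
    ≡⟨ cong₂ (λ a b → a * k ! + b)
         (m%[n*o]/o≡m/o%n m (suc k) (k !))
         (m∣n⇒o%n%m≡o%m (k !) (suc k !) m (n∣m*n (suc k))) ⟩
  ((m / k !) % suc k) * k ! + m % k !  ∎
  where
  open ≡-Reasoning
  instance
    _ : NonZero (k !)
    _ = k !≢0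
    _ : NonZero (suc k !)
    _ = suc k !≢0
  x = m %! suc k

factorialDigit : ℕ → ℕ → ℕ
factorialDigit m i = (m /! i) % suc i

factorialDigit-Σ : ∀ m k →
  sum (applyDownFrom (λ i → factorialDigit m i * i !) k) ≡ m %! k
factorialDigit-Σ m zero    = sym (n%1≡0 m)
factorialDigit-Σ m (suc k) = trans
  (cong (factorialDigit m k * k ! +_) (factorialDigit-Σ m k))
  (sym (%!-suc m k))

factorialRep : ∀ k m → m < k ! → FactorialRep k m
factorialRep k m m<k! = record
  { digit   = factorialDigit m
  ; digit≤  = λ i _ → s≤s⁻¹ (m%n<n (m /! i) (suc i))
  ; digit-Σ = trans (factorialDigit-Σ m k) (m<n⇒m%n≡m {{k !≢0}} m<k!)
  }

perm2nth : Permutation → ℕ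
perm2nth p = sum (tabulate λ (i : Fin k) → lookup c i * (k ∸ suc (toℕ i)) !)
  where
  c = lehmerCode p
  k = length c

nth2perm : (k m : ℕ) → m < k ! → Permutation
nth2perm k m m<k! = fromLehmerCode code code-isLehmerCode
  where open FactorialRep (factorialRep k m m<k!)

-- sf k = 0! + 1! + … + (k-1)!
sf : ℕ → ℕ
sf zero    = 0
sf (suc k) = sf k + k !

sf-<-suc : ∀ k → sf k < sf (suc k)
sf-<-suc k = m<m+n (sf k) (1≤n! k)

sf-mono-≤ : ∀ {j k} → j ≤ k → sf j ≤ sf k
sf-mono-≤             z≤n = z≤n
sf-mono-≤ {j} {suc k} j≤1+k with j ≟ suc k
... | yes refl = ≤-refl
... | no j≢    = ≤-trans (sf-mono-≤ (s≤s⁻¹ (≤∧≢⇒< j≤1+k j≢))) (<⇒≤ (sf-<-suc k))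

InBlock : ℕ → ℕ → Set
InBlock n k = sf k ≤ n × n < sf (suc k)

InBlock-≤ : ∀ {n j k} → InBlock n j → InBlock n k → j ≤ k
InBlock-≤ (sfj≤n , _) (_ , n<sf1+k) =
  ≮⇒≥ λ k<j → <-irrefl refl (<-≤-trans n<sf1+k (≤-trans (sf-mono-≤ k<j) sfj≤n))

findBlock : ∀ n → Σ ℕ (InBlock n)
findBlock zero    = 0 , z≤n , s≤s z≤n
findBlock (suc n) with findBlock n
... | k , sfk≤n , n<sf1+k with suc n <? sf (suc k)
...   | yes 1+n< = k , m≤n⇒m≤1+n sfk≤n , 1+n<
...   | no  1+n≮ = suc k , ≮⇒≥ 1+n≮ , ≤-<-trans n<sf1+k (sf-<-suc (suc k))

block : ∀ n → ∃! _≡_ (InBlock n)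
block n with findBlock n
... | k , k-ok = k , k-ok , λ j-ok → ≤-antisym (InBlock-≤ k-ok j-ok) (InBlock-≤ j-ok k-ok)

InBlock⇒<! : ∀ n k → InBlock n k → n ∸ sf k < k !
InBlock⇒<! n k (sfk≤n , n<) =
  +-cancelˡ-< (sf k) _ _ (subst (_< sf (suc k)) (sym (m+[n∸m]≡n sfk≤n)) n<)

perm2nat : Permutation → ℕ
perm2nat (mkPermutation []      _)  = 0
perm2nat p@(mkPermutation (_ ∷ _) _) = sf (size p) + perm2nth p

nat2perm : ℕ → Permutation
nat2perm zero      = mkPermutation [] []
nat2perm n@(suc _) = nth2perm k (n ∸ sf k) (InBlock⇒<! n k inBlock)
  where
  k       = proj₁ (block n)
  inBlock = proj₁ (proj₂ (block n))

{-# OPTIONS --safe #-}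
module Submission where

-- Each of the two maps is described by a Lehmer code: `select` and `lehmer`
-- match permutations of size k with codes of length k, and a code cs is sent
-- to the number sf k + value cs.  As value cs < k!, the numbers of the codes of
-- length k lie in the k-th block, so the number determines k; reading
-- value cs modulo factorials then determines cs.  Hence the code used by
-- `nat2perm` at `perm2nat p` is the Lehmer code of p, and conversely.

open import Defs
open import Data.Nat.Base using (ℕ; zero; suc; pred; _+_; _*_; _∸_; _%_; _!; _≤_; _<_; s≤s; s≤s⁻¹)
open import Data.Nat.Properties
open import Data.Nat.DivMod using ([m+kn]%n≡m%n; m<n⇒m%n≡m)
open import Data.Nat.ListAction using (sum)
open import Data.Fin.Base using (Fin; zero; suc; toℕ; fromℕ<)
open import Data.Fin.Properties using (toℕ<n; toℕ-fromℕ<; fromℕ<-toℕ)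
open import Data.List.Base using (List; []; _∷_; length; filter; lookup; removeAt; tabulate; upTo; applyDownFrom)
open import Data.List.Properties using (length-upTo; length-applyDownFrom; length-removeAt; length-removeAt′)
open import Data.List.Membership.Propositional using (_∈_)
open import Data.List.Membership.Propositional.Properties using (∈-lookup; ∈-filter⁻)
open import Data.List.Membership.DecPropositional _≟_ using (_∈?_)
open import Data.List.Relation.Binary.Permutation.Propositional using (_↭_; prep; ↭-refl; ↭-sym; ↭-trans; ↭⇒↭ₛ)
open import Data.List.Relation.Binary.Permutation.Propositional.Properties using (↭-length; ∈-resp-↭; drop-∷)
import Data.List.Relation.Binary.Permutation.Setoid.Properties as Permutationₛ
open import Data.List.Relation.Unary.All as All using (All; []; _∷_)
open import Data.List.Relation.Unary.AllPairs using ([]; _∷_)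
open import Data.List.Relation.Unary.Any using (here; there; index)
open import Data.List.Relation.Unary.Any.Properties using (lookup-index)
open import Data.List.Relation.Unary.Unique.Propositional using (Unique)
open import Data.List.Relation.Unary.Unique.Propositional.Properties using (upTo⁺)
open import Data.Product using (_×_; _,_; proj₁; proj₂; ∃; ∃-syntax)
open import Data.Unit.Base using (tt)
open import Function.Base using (_∘_; id)
open import Relation.Binary.PropositionalEquality using (_≡_; _≗_; refl; sym; trans; cong; cong₂; subst; setoid; module ≡-Reasoning)
open import Relation.Nullary using (yes; no; contradiction)

private
  variable
    A : Set
    xs ps cs : List ℕ

-- Duplicate-free lists and permutations

∈⇒lookup : ∀ {x : A} {xs} → x ∈ xs → ∃[ i ] lookup xs i ≡ x
∈⇒lookup x∈xs = index x∈xs , sym (lookup-index x∈xs)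

Unique⇒lookup-injective : ∀ {xs : List A} → Unique xs →
                          ∀ {i j} → lookup xs i ≡ lookup xs j → i ≡ j
Unique⇒lookup-injective (_ ∷ _)  {zero}  {zero}  _  = refl
Unique⇒lookup-injective (x∉ ∷ _) {zero}  {suc j} eq =
  contradiction eq (All.lookup x∉ (∈-lookup j))
Unique⇒lookup-injective (x∉ ∷ _) {suc i} {zero}  eq =
  contradiction (sym eq) (All.lookup x∉ (∈-lookup i))
Unique⇒lookup-injective (_ ∷ u)  {suc i} {suc j} eq =
  cong suc (Unique⇒lookup-injective u eq)

Unique-removeAt : Unique xs → ∀ i → Unique (removeAt xs i)
Unique-removeAt {xs} u i
  with _ ∷ u′ ← Permutationₛ.Unique-resp-↭ (setoid ℕ)
                  (↭⇒↭ₛ (↭-sym (lookup∷removeAt-↭ xs i))) u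
  = u′

-- Pigeonhole by induction on `xs`: its head is removed from `ps`, and the other entries of `xs`,
-- being different from it, survive the removal. At the end the length bound leaves no room for
-- extra entries.
Unique∧⊆∧length≤⇒↭ : Unique xs → All (_∈ ps) xs → length ps ≤ length xs → ps ↭ xs
Unique∧⊆∧length≤⇒↭ {ps = []} [] [] _ = ↭-refl
Unique∧⊆∧length≤⇒↭ {ps = ps} (x∉ ∷ u) (x∈ ∷ xs⊆) len with ∈⇒lookup x∈
... | i , refl = ↭-trans (↭-sym (lookup∷removeAt-↭ ps i)) (prep _
  (Unique∧⊆∧length≤⇒↭ u
    (All.zipWith (λ (x≢y , y∈) → tail x≢y (∈-resp-↭ (↭-sym (lookup∷removeAt-↭ ps i)) y∈)) (x∉ , xs⊆))
    (s≤s⁻¹ (subst (_≤ _) (length-removeAt′ ps i) len))))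
  where
  tail : ∀ {x y : ℕ} {ys} → (x ≡ y → _) → y ∈ x ∷ ys → y ∈ ys
  tail x≢y (here refl) = contradiction refl x≢y
  tail x≢y (there y∈)  = y∈

occurrences≡1⇒∈ : ∀ v ps → occurrences v ps ≡ 1 → v ∈ ps
occurrences≡1⇒∈ v ps eq with filter (v ≟_) ps in filter≡
... | q ∷ _
  with q∈ , refl ← ∈-filter⁻ (v ≟_) {xs = ps} (subst (q ∈_) (sym filter≡) (here refl))
  = q∈

-- The `size p` distinct values of `upTo` all occur among `size p` entries, so no other entry and no
-- repetition fits.
elements-↭ : ∀ p → elements p ↭ upTo (size p)
elements-↭ p = Unique∧⊆∧length≤⇒↭ (upTo⁺ (size p))
  (All.map (λ {v} → occurrences≡1⇒∈ v (elements p)) (isPermutation p))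
  (≤-reflexive (sym (length-upTo (size p))))

elements-injective : ∀ {p q} → elements p ≡ elements q → p ≡ q
elements-injective {mkPermutation ps ok} {mkPermutation _ ok′} refl =
  cong (mkPermutation ps) (All.irrelevant ≡-irrelevant ok ok′)

-- Selections and their codes

-- The common graph of `select xs` and, when xs is duplicate-free, `lehmer xs`.
data Selects : (xs ps cs : List ℕ) → Set where
  []  : Selects [] [] []
  _∷_ : ∀ i → Selects (removeAt xs i) ps cs →
        Selects xs (lookup xs i ∷ ps) (toℕ i ∷ cs)

Selects⇒select : Selects xs ps cs → select xs cs ≡ ps
Selects⇒select [] = refl
Selects⇒select {xs} (i ∷ s) with toℕ i <? length xs
... | no i≮ = contradiction (toℕ<n i) i≮
... | yes i< rewrite fromℕ<-toℕ i i< = cong (lookup xs i ∷_) (Selects⇒select s)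

Selects⇒lehmer : Unique xs → Selects xs ps cs → lehmer xs ps ≡ cs
Selects⇒lehmer u [] = refl
Selects⇒lehmer {xs} u (i ∷ s) with lookup xs i ∈? xs
... | no ∉xs = contradiction (∈-lookup i) ∉xs
-- The membership test returns some position of the entry; only the absence of duplicates forces it
-- to be `i`.
... | yes ∈xs rewrite Unique⇒lookup-injective u {index ∈xs} {i} (sym (lookup-index ∈xs)) =
  cong (toℕ i ∷_) (Selects⇒lehmer (Unique-removeAt u i) s)

Selects-length : Selects xs ps cs → length cs ≡ length xs
Selects-length [] = refl
Selects-length {xs} (i ∷ s) =
  trans (cong suc (Selects-length s)) (sym (length-removeAt′ xs i))

Selects⇒IsLehmerCode : Selects xs ps cs → IsLehmerCode cs
Selects⇒IsLehmerCode [] = tt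
Selects⇒IsLehmerCode is@(i ∷ s) =
  s≤s⁻¹ (subst (toℕ i <_) (sym (Selects-length is)) (toℕ<n i)) ,
  Selects⇒IsLehmerCode s

Selects-length-elements : Selects xs ps cs → length cs ≡ length ps
Selects-length-elements []      = refl
Selects-length-elements (_ ∷ s) = cong suc (Selects-length-elements s)

↭⇒Selects : ∀ {xs} ps → ps ↭ xs → ∃ (Selects xs ps)
↭⇒Selects {[]}    []       ps↭ = [] , []
↭⇒Selects {_ ∷ _} []       ps↭ = contradiction (↭-length ps↭) λ ()
↭⇒Selects {xs}    (p ∷ ps) ps↭ with ∈⇒lookup (∈-resp-↭ ps↭ (here refl))
... | i , refl =
  let cs , s = ↭⇒Selects ps (drop-∷ (↭-trans ps↭ (↭-sym (lookup∷removeAt-↭ xs i))))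
  in  toℕ i ∷ cs , i ∷ s

IsLehmerCode⇒Selects : ∀ {xs} cs → IsLehmerCode cs → length cs ≡ length xs →
                       ∃ λ ps → Selects xs ps cs
IsLehmerCode⇒Selects {[]} []       _         _  = [] , []
IsLehmerCode⇒Selects {xs} (c ∷ cs) (c≤ , ok) eq
  with c<   ← subst (c <_) eq (s≤s c≤)
  -- Abstracting the bounded position together with its equation replaces `c` by `toℕ i`, the form
  -- that the constructor requires.
  with fromℕ< c< | toℕ-fromℕ< c<
... | i | refl =
  let ps , s = IsLehmerCode⇒Selects cs ok
                 (trans (cong pred eq) (sym (length-removeAt xs i)))
  in  lookup xs i ∷ ps , i ∷ s

-- Factorial number system, leading digit first

value : List ℕ → ℕ
value []       = 0
value (c ∷ cs) = c * length cs ! + value cs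

-- The factorial's argument counts the digits to the right and computes along the list, so the head
-- term and the tail sum match definitionally.
value-tabulate : ∀ cs →
  sum (tabulate λ (i : Fin (length cs)) → lookup cs i * (length cs ∸ suc (toℕ i)) !) ≡ value cs
value-tabulate []       = refl
value-tabulate (c ∷ cs) = cong (c * length cs ! +_) (value-tabulate cs)

value-applyDownFrom : ∀ (d : ℕ → ℕ) k →
  sum (applyDownFrom (λ i → d i * i !) k) ≡ value (applyDownFrom d k)
value-applyDownFrom d zero    = refl
value-applyDownFrom d (suc k) = cong₂ _+_
  (cong (λ j → d k * j !) (sym (length-applyDownFrom d k)))
  (value-applyDownFrom d k)

value<! : ∀ cs → IsLehmerCode cs → value cs < length cs !
value<! []       _         = ≤-refl
value<! (c ∷ cs) (c≤ , ok) = begin-strict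
  c * n ! + value cs  ≡⟨ +-comm (c * n !) _ ⟩
  -- The extreme case is `c = n`: then `n ! + n * n !` is `suc n !` by definition.
  value cs + c * n !  <⟨ +-mono-<-≤ (value<! cs ok) (*-monoˡ-≤ (n !) c≤) ⟩
  suc n !             ∎
  where
  open ≤-Reasoning
  n = length cs

value-∷-%! : ∀ c cs → IsLehmerCode cs → value (c ∷ cs) %! length cs ≡ value cs
value-∷-%! c cs ok = begin
  (c * n ! + value cs) % n !  ≡⟨ cong (_% n !) (+-comm (c * n !) _) ⟩
  (value cs + c * n !) % n !  ≡⟨ [m+kn]%n≡m%n (value cs) c (n !) ⟩
  value cs % n !              ≡⟨ m<n⇒m%n≡m (value<! cs ok) ⟩
  value cs                    ∎
  where
  open ≡-Reasoning
  n = length cs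
  instance _ = n !≢0

-- Modulo the factorial of the tail's length the leading term vanishes, so the tails have equal
-- values; cancelling these leaves the leading digits.
value-injective : ∀ cs ds → IsLehmerCode cs → IsLehmerCode ds →
                  length cs ≡ length ds → value cs ≡ value ds → cs ≡ ds
value-injective []       []       _         _         _   _  = refl
value-injective (c ∷ cs) (d ∷ ds) (_ , okc) (_ , okd) len eq =
  cong₂ _∷_ heads≡ (value-injective cs ds okc okd lengths≡ tails≡)
  where
  open ≡-Reasoning
  lengths≡ : length cs ≡ length ds
  lengths≡ = cong pred len
  tails≡ : value cs ≡ value ds
  tails≡ = begin
    value cs                    ≡⟨ value-∷-%! c cs okc ⟨
    value (c ∷ cs) %! length cs ≡⟨ cong₂ _%!_ eq lengths≡ ⟩
    value (d ∷ ds) %! length ds ≡⟨ value-∷-%! d ds okd ⟩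
    value ds                    ∎
  heads≡ : c ≡ d
  heads≡ = *-cancelʳ-≡ c d (length cs !) {{length cs !≢0}}
    (+-cancelʳ-≡ (value cs) _ _ (trans eq
      (cong₂ (λ k v → d * k ! + v) (sym lengths≡) (sym tails≡))))

-- Numbers of codes and the two inverse laws

number : List ℕ → ℕ
number cs = sf (length cs) + value cs

number-InBlock : ∀ cs → IsLehmerCode cs → InBlock (number cs) (length cs)
number-InBlock cs ok = m≤m+n _ _ , +-monoʳ-< (sf (length cs)) (value<! cs ok)

-- Blocks do not overlap, so the common number fixes the length; then `sf` cancels and the values
-- decide.
number-injective : ∀ {cs ds} → IsLehmerCode cs → IsLehmerCode ds →
                   number cs ≡ number ds → cs ≡ ds
number-injective {cs} {ds} okc okd eq = value-injective cs ds okc okd len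
  (+-cancelˡ-≡ (sf (length cs)) _ _
    (trans eq (cong (λ k → sf k + value ds) (sym len))))
  where
  cs-ok = subst (λ n → InBlock n (length cs)) eq (number-InBlock cs okc)
  ds-ok = number-InBlock ds okd
  len : length cs ≡ length ds
  len = ≤-antisym (InBlock-≤ cs-ok ds-ok) (InBlock-≤ ds-ok cs-ok)

nat2perm-code : ∀ n → ∃[ cs ] IsLehmerCode cs × number cs ≡ n ×
                              elements (nat2perm n) ≡ select (upTo (length cs)) cs
-- The separate clause of `nat2perm` at zero fits the empty code, whose number is `sf 0 + 0`.
nat2perm-code zero      = [] , tt , refl , refl
nat2perm-code n@(suc _) = code , code-isLehmerCode , number-code , refl
  where
  k       = proj₁ (block n)
  inBlock = proj₁ (proj₂ (block n))
  open FactorialRep (factorialRep k (n ∸ sf k) (InBlock⇒<! n k inBlock))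
  open ≡-Reasoning
  number-code : number code ≡ n
  number-code = begin
    sf (length code) + value code  ≡⟨ cong₂ _+_ (cong sf (length-applyDownFrom digit k))
                                        (trans (sym (value-applyDownFrom digit k)) digit-Σ) ⟩
    sf k + (n ∸ sf k)              ≡⟨ m+[n∸m]≡n (proj₁ inBlock) ⟩
    n                              ∎

elements-nat2perm : Selects (upTo (length cs)) ps cs →
                    elements (nat2perm (number cs)) ≡ ps
elements-nat2perm {cs} s
  with ds , ok , eq , elements≡ ← nat2perm-code (number cs)
  with refl ← number-injective ok (Selects⇒IsLehmerCode s) eq
  = trans elements≡ (Selects⇒select s)

-- `perm2nth` takes its length from the code, `perm2nat` from the permutation. The hypothesis
-- reconciles them, since `lehmer` could in principle stop early.
perm2nat-lehmerCode : ∀ p → length (lehmerCode p) ≡ size p →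
                      perm2nat p ≡ number (lehmerCode p)
perm2nat-lehmerCode (mkPermutation []      _) _     = refl
perm2nat-lehmerCode p@(mkPermutation (_ ∷ _) _) len =
  cong₂ _+_ (cong sf (sym len)) (value-tabulate (lehmerCode p))

perm2nat-Selects : ∀ {cs} p → Selects (upTo (size p)) (elements p) cs →
                   perm2nat p ≡ number cs
perm2nat-Selects {cs} p s
  -- From here on `cs` is `lehmerCode p` itself.
  with refl ← Selects⇒lehmer (upTo⁺ (size p)) s
  = perm2nat-lehmerCode p (Selects-length-elements s)

nat2perm∘perm2nat : nat2perm ∘ perm2nat ≗ id
nat2perm∘perm2nat p
  with cs , s ← ↭⇒Selects (elements p) (elements-↭ p)
  rewrite perm2nat-Selects p s
  = elements-injective (elements-nat2perm
      (subst (λ k → Selects (upTo k) (elements p) cs)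
        (sym (Selects-length-elements s)) s))

perm2nat∘nat2perm : perm2nat ∘ nat2perm ≗ id
perm2nat∘nat2perm n
  with cs , ok , refl , elements≡ ← nat2perm-code n
  with ps , s ← IsLehmerCode⇒Selects cs ok (sym (length-upTo (length cs)))
  -- The inner transport replaces the code's length by that of `ps`, the outer one `ps` by the
  -- entries of `nat2perm n`.
  = perm2nat-Selects (nat2perm n) (subst (λ qs → Selects (upTo (length qs)) qs cs)
      (sym (trans elements≡ (Selects⇒select s)))
      (subst (λ k → Selects (upTo k) ps cs) (Selects-length-elements s) s))

proposition8 : (nat2perm ∘ perm2nat ≗ id {A = Permutation}) × (perm2nat ∘ nat2perm ≗ id {A = ℕ})
proposition8 = nat2perm∘perm2nat , perm2nat∘nat2perm
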